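{- Let $k$ be a positive integer, let $G$ be a graph, and let $A\in\mathcal{S}(G)$ be a matrix that has an eigenvalue $\lambda$ with an eigenvector $y$ all of whose entries are nonzero. Let $p(x)\in\mathbb{R}_k[x]$ be a polynomial such that $p(A)$ is positive semidefinite and $p(\lambda)>0$. Then $$\alpha_k(G)\leq\frac{y^\top y}{p(\lambda)}\max_{u\in V(G)}\frac{(p(A))_{uu}}{y_u^2}.$$
   Context: Graphs are finite, simple, undirected, with nonempty vertex set $V(G)$. $d(i,j)$ denotes the distance between vertices $i$ and $j$ in $G$ (with $d(i,j)=\infty$ if they lie in different components). A $k$-independent set of $G$ is a subset $U\subseteq V(G)$ with $d(i,j)>k$ for any two distinct $i,j\in U$; $\alpha_k(G)$ is the maximum size of a $k$-independent set. $\mathbb{R}_k[x]$ is the set of real polynomials of degree at most $k$. $\mathcal{S}(G)$ is the set of real symmetric matrices $A$ indexed by the vertices of $G$ such that $(A)_{ij}=0$ whenever $d(i,j)>1$ (diagonal entries are arbitrary). The eigenvector $y$ is real. -}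

module Defs where

open import Algebra.Apartness.Bundles using (HeytingField)
open import Algebra.Bundles using (CommutativeRing; Semiring)
import Algebra.Apartness.Properties.HeytingCommutativeRing as HeytingProperties
import Algebra.Definitions.RawSemiring as RawSemiringDefinitions
open import Data.Fin.Base using (Fin; zero; suc; toℕ)
open import Data.Fin.Properties using (any?; all?; pigeonhole; toℕ≤pred[n])
  renaming (_≟_ to _≟ᶠ_)
open import Data.Fin.Subset using (Subset; _∈_; ∣_∣; ⊥)
open import Data.Fin.Subset.Properties using (_∈?_; anySubset?; ∉⊥; ∣⊥∣≡0; ∣p∣≤n)
open import Data.List.Base using (filter; upTo)
open import Data.List.Extrema.Nat using (max; xs≤max; argmax-all)
open import Data.List.Membership.Propositional.Properties using (∈-filter⁺; ∈-upTo⁺)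
open import Data.List.Relation.Unary.All using (lookup)
open import Data.List.Relation.Unary.All.Properties using (all-filter)
open import Data.Nat.Base as ℕ using (ℕ; zero; suc)
import Data.Nat.Properties as ℕ
open import Data.Nat.Induction using (<-rec)
open import Data.Product.Base using (_×_; _,_; ∃-syntax; proj₁)
open import Data.Sum.Base using (_⊎_)
open import Data.Vec.Functional using (Vector; head; tail)
open import Function.Base using (id)
open import Level using (0ℓ; _⊔_) renaming (suc to lsuc)
open import Relation.Binary.Construct.Add.Supremum.Strict ℕ._<_ using (_<⁺_; <⁺-dec)
open import Relation.Binary.Construct.Add.Supremum.NonStrict ℕ._≤_ using (_≤⁺_; ≤⁺-trans; [_])
open import Relation.Binary.Core using (Rel)
open import Relation.Binary.Definitions using (Decidable; Symmetric; Irreflexive)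
open import Relation.Binary.Lattice.Definitions using (Supremum)
open import Relation.Binary.PropositionalEquality.Core using (_≡_; _≢_; refl; sym; subst)
open import Relation.Binary.Structures using (IsStrictPartialOrder)
open import Relation.Nullary.Construct.Add.Supremum using (_⁺; ⊤⁺; [_])
open import Relation.Nullary.Decidable.Core as Dec using (yes; no; ¬?; _×-dec_; _→-dec_)
open import Relation.Nullary.Negation.Core using (¬_; contradiction)
import Relation.Unary as Unary

private
  variable
    n : ℕ

-- The library has no real numbers, so ℝ enters axiomatically, as an
-- Archimedean Cauchy-complete ordered field.  Classically these axioms
-- determine ℝ up to isomorphism; they are phrased constructively (with
-- x # y for "x ≠ y" and x ≤ y for "not y < x") so that no decision
-- procedure for the order is presupposed.
record RealField c ℓ₁ ℓ₂ : Set (lsuc (c ⊔ ℓ₁ ⊔ ℓ₂)) where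
  field
    heytingField : HeytingField c ℓ₁ ℓ₂

  open HeytingField heytingField public
    hiding (refl; sym; trans; reflexive)

  commutativeRing : CommutativeRing c ℓ₁
  commutativeRing = record { isCommutativeRing = isCommutativeRing }

  open CommutativeRing commutativeRing public using (semiring; refl; sym; trans; reflexive)
  open RawSemiringDefinitions (Semiring.rawSemiring semiring) public
    using (_^_; sum) renaming (_×_ to _·ℕ_)

  fromℕ : ℕ → Carrier
  fromℕ n = n ·ℕ 1#

  infix 4 _<_ _≤_

  field
    _<_                  : Rel Carrier ℓ₂
    isStrictPartialOrder : IsStrictPartialOrder _≈_ _<_
    #⇒<⊎>                : ∀ {x y} → x # y → x < y ⊎ y < x
    <⇒#                  : ∀ {x y} → x < y → x # y
    0<1                  : 0# < 1#
    +-monoʳ-<            : ∀ z {x y} → x < y → z + x < z + y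
    *-pos                : ∀ {x y} → 0# < x → 0# < y → 0# < x * y

  _≤_ : Rel Carrier ℓ₂
  x ≤ y = ¬ (y < x)

  -- Cauchy s says |s i - s j| < ε for all large i and j: the bound
  -- s i - s j < ε is required for both orders of i and j.
  Cauchy : (ℕ → Carrier) → Set (c ⊔ ℓ₂)
  Cauchy s = ∀ ε → 0# < ε → ∃[ N ] (∀ i j → N ℕ.≤ i → N ℕ.≤ j → s i - s j < ε)

  _ConvergesTo_ : (ℕ → Carrier) → Carrier → Set (c ⊔ ℓ₂)
  s ConvergesTo l =
    ∀ ε → 0# < ε → ∃[ N ] (∀ i → N ℕ.≤ i → s i - l < ε × l - s i < ε)

  infixr 6 _∨_

  field
    archimedean : ∀ x → ∃[ n ] x < fromℕ n
    complete    : ∀ s → Cauchy s → ∃[ l ] s ConvergesTo l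
    -- Binary maximum.  It is determined by the order, and classically
    -- redundant.
    _∨_         : Carrier → Carrier → Carrier
    ∨-supremum  : Supremum _≤_ _∨_

  open HeytingProperties heytingCommutativeRing public using (x#0y#0→xy#0)

  -- For x # y the library inverts x - y; take y = 0#.
  reciprocal : ∀ x → x # 0# → Carrier
  reciprocal x x#0 = proj₁ (#⇒invertible x#0)

  divide : Carrier → ∀ y → y # 0# → Carrier
  divide x y y#0 = x * reciprocal y y#0

  syntax divide x y y#0 = x / y [ y#0 ]

  0<⇒#0 : ∀ {x} → 0# < x → x # 0#
  0<⇒#0 0<x = #-sym (<⇒# 0<x)

  maximum : Vector Carrier (suc n) → Carrier
  maximum {zero}  f = head f
  maximum {suc n} f = head f ∨ maximum (tail f)

-- Finite simple undirected graphs with vertex set Fin n.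
record Graph (n : ℕ) : Set₁ where
  infix 4 _~_
  field
    _~_      : Rel (Fin n) 0ℓ
    ~-sym    : Symmetric _~_
    ~-irrefl : Irreflexive _≡_ _~_
    _~?_     : Decidable _~_

-- The least m with i ≤ m < i + b and P m, or ⊤⁺ if there is none.
leastFrom : {P : Unary.Pred ℕ 0ℓ} → Unary.Decidable P → (i b : ℕ) → ℕ ⁺
leastFrom P? i zero    = ⊤⁺
leastFrom P? i (suc b) with P? i
... | yes _ = [ i ]
... | no  _ = leastFrom P? (suc i) b

module _ {P : Unary.Pred ℕ 0ℓ} (P? : Unary.Decidable P) where

  leastFrom-sound : ∀ i b {m} → leastFrom P? i b ≡ [ m ] → P m
  leastFrom-sound i (suc b) eq with P? i
  leastFrom-sound i (suc b) refl | yes Pi = Pi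
  leastFrom-sound i (suc b) eq   | no  _  = leastFrom-sound (suc i) b eq

  leastFrom-minimal : ∀ i b {m} → P m → i ℕ.≤ m → m ℕ.< i ℕ.+ b → leastFrom P? i b ≤⁺ [ m ]
  leastFrom-minimal i zero Pm i≤m m<i+0 =
    contradiction (subst (_ ℕ.<_) (ℕ.+-identityʳ i) m<i+0) (ℕ.≤⇒≯ i≤m)
  leastFrom-minimal i (suc b) {m} Pm i≤m m<i+b with P? i
  ... | yes _  = [ i≤m ]
  ... | no ¬Pi = leastFrom-minimal (suc i) b Pm
    (ℕ.≤∧≢⇒< i≤m λ { refl → ¬Pi Pm })
    (subst (m ℕ.<_) (ℕ.+-suc i b) m<i+b)

module _ (G : Graph n) where
  open Graph G

  data Walk : ℕ → Rel (Fin n) 0ℓ where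
    nil  : ∀ {u} → Walk 0 u u
    cons : ∀ {m u v w} → u ~ v → Walk m v w → Walk (suc m) u w

  walk? : ∀ m → Decidable (Walk m)
  walk? zero    u w = Dec.map′ (λ { refl → nil }) (λ { nil → refl }) (u ≟ᶠ w)
  walk? (suc m) u w = Dec.map′
    (λ { (_ , u~v , p) → cons u~v p })
    (λ { (cons u~v p) → _ , u~v , p })
    (any? λ v → (u ~? v) ×-dec walk? m v w)

  -- It suffices to search walks of length < n; see dist-minimal.
  dist : Fin n → Fin n → ℕ ⁺
  dist u v = leastFrom (λ m → walk? m u v) 0 n

  vertex : ∀ {m u v} → Walk m u v → Fin (suc m) → Fin n
  vertex {u = u} p          zero    = u
  vertex         (cons _ p) (suc i) = vertex p i

  takeWalk : ∀ {m u v} (p : Walk m u v) i → Walk (toℕ i) u (vertex p i)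
  takeWalk p          zero    = nil
  takeWalk (cons e p) (suc i) = cons e (takeWalk p i)

  dropWalk : ∀ {m u v} (p : Walk m u v) i → Walk (m ℕ.∸ toℕ i) (vertex p i) v
  dropWalk p          zero    = p
  dropWalk (cons e p) (suc i) = dropWalk p i

  append : ∀ {l m u v w} → Walk l u v → Walk m v w → Walk (l ℕ.+ m) u w
  append nil        q = q
  append (cons e p) q = cons e (append p q)

  shorten : ∀ {m u v} → n ℕ.≤ m → Walk m u v → ∃[ l ] l ℕ.< m × Walk l u v
  shorten {m} {u} {v} n≤m p with pigeonhole (ℕ.s≤s n≤m) (vertex p)
  ... | i , j , i<j , pᵢ≡pⱼ =
    toℕ i ℕ.+ (m ℕ.∸ toℕ j) ,
    subst (toℕ i ℕ.+ (m ℕ.∸ toℕ j) ℕ.<_) (ℕ.m+[n∸m]≡n (toℕ≤pred[n] j))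
      (ℕ.+-monoˡ-< (m ℕ.∸ toℕ j) i<j) ,
    append (takeWalk p i) (subst (λ x → Walk _ x v) (sym pᵢ≡pⱼ) (dropWalk p j))

  ShortWalk : (u v : Fin n) → ℕ → Set
  ShortWalk u v m = Walk m u v → ∃[ l ] l ℕ.≤ m × l ℕ.< n × Walk l u v

  shortWalk : ∀ {u v} m → ShortWalk u v m
  shortWalk {u} {v} = <-rec (ShortWalk u v) step
    where
    step : ∀ m → (∀ {l} → l ℕ.< m → ShortWalk u v l) → ShortWalk u v m
    step m rec p with m ℕ.<? n
    ... | yes m<n = m , ℕ.≤-refl , m<n , p
    ... | no  m≮n with shorten (ℕ.≮⇒≥ m≮n) p
    ...   | l , l<m , q with rec l<m q
    ...     | l′ , l′≤l , l′<n , r = l′ , ℕ.≤-trans l′≤l (ℕ.<⇒≤ l<m) , l′<n , r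

  dist-sound : ∀ {u v m} → dist u v ≡ [ m ] → Walk m u v
  dist-sound = leastFrom-sound (λ m → walk? m _ _) 0 n

  dist-minimal : ∀ {u v m} → Walk m u v → dist u v ≤⁺ [ m ]
  dist-minimal p with shortWalk _ p
  ... | l , l≤m , l<n , q =
    ≤⁺-trans ℕ.≤-trans (leastFrom-minimal (λ m → walk? m _ _) 0 n q ℕ.z≤n l<n) [ l≤m ]

  Far : ℕ → Rel (Fin n) 0ℓ
  Far k u v = [ k ] <⁺ dist u v

  Independent : ℕ → Subset n → Set
  Independent k U = ∀ i j → i ∈ U → j ∈ U → i ≢ j → Far k i j

  independent? : ∀ k → Unary.Decidable (Independent k)
  independent? k U = all? λ i → all? λ j →
    (i ∈? U) →-dec (j ∈? U) →-dec ¬? (i ≟ᶠ j) →-dec <⁺-dec ℕ._<?_ [ k ] (dist i j)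

  IndependentOfSize : (k m : ℕ) → Set
  IndependentOfSize k m = ∃[ U ] Independent k U × ∣ U ∣ ≡ m

  independentOfSize? : ∀ k → Unary.Decidable (IndependentOfSize k)
  independentOfSize? k m = anySubset? λ U → independent? k U ×-dec (∣ U ∣ ℕ.≟ m)

  independenceNumber : ℕ → ℕ
  independenceNumber k = max 0 (filter (independentOfSize? k) (upTo (suc n)))

  independenceNumber-attained : ∀ k → IndependentOfSize k (independenceNumber k)
  independenceNumber-attained k = argmax-all id {P = IndependentOfSize k}
    (⊥ , (λ _ _ i∈⊥ → contradiction i∈⊥ ∉⊥) , ∣⊥∣≡0 n)
    (all-filter (independentOfSize? k) (upTo (suc n)))

  independenceNumber-max : ∀ k U → Independent k U → ∣ U ∣ ℕ.≤ independenceNumber k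
  independenceNumber-max k U ind = lookup (xs≤max 0 _)
    (∈-filter⁺ (independentOfSize? k) (∈-upTo⁺ (ℕ.s≤s (∣p∣≤n U))) (U , ind , refl))

module LinearAlgebra {c ℓ₁ ℓ₂} (R : RealField c ℓ₁ ℓ₂) where
  open RealField R public

  Matrix : ℕ → Set c
  Matrix n = Fin n → Fin n → Carrier

  infix  8 _·_
  infixr 7 _*ᵥ_ _*ᴹ_

  _·_ : Vector Carrier n → Vector Carrier n → Carrier
  x · y = sum λ i → x i * y i

  _*ᵥ_ : Matrix n → Vector Carrier n → Vector Carrier n
  (A *ᵥ x) u = A u · x

  _*ᴹ_ : Matrix n → Matrix n → Matrix n
  (A *ᴹ B) u v = A u · λ w → B w v

  1ᴹ : Matrix n
  1ᴹ u v with u ≟ᶠ v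
  ... | yes _ = 1#
  ... | no  _ = 0#

  infixr 8 _^ᴹ_

  _^ᴹ_ : Matrix n → ℕ → Matrix n
  A ^ᴹ zero  = 1ᴹ
  A ^ᴹ suc m = A *ᴹ A ^ᴹ m

  SymmetricMatrix : Matrix n → Set ℓ₁
  SymmetricMatrix A = ∀ u v → A u v ≈ A v u

  PositiveSemidefinite : Matrix n → Set (c ⊔ ℓ₁ ⊔ ℓ₂)
  PositiveSemidefinite A = SymmetricMatrix A × (∀ x → 0# ≤ x · (A *ᵥ x))

  IsEigenvector : Matrix n → Carrier → Vector Carrier n → Set (ℓ₁ ⊔ ℓ₂)
  IsEigenvector A μ y = (∃[ u ] y u # 0#) × (∀ u → (A *ᵥ y) u ≈ μ * y u)

  𝒮 : Graph n → Matrix n → Set ℓ₁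
  𝒮 G A = SymmetricMatrix A × (∀ u v → Far G 1 u v → A u v ≈ 0#)

  -- ℝₖ[x]: the polynomial Σ_{i ≤ k} pᵢ xⁱ is given by its coefficients, and
  -- pₖ may be zero.
  Polynomial≤ : ℕ → Set c
  Polynomial≤ k = Vector Carrier (suc k)

  eval : ∀ {k} → Polynomial≤ k → Carrier → Carrier
  eval p x = sum λ i → p i * x ^ toℕ i

  evalᴹ : ∀ {k} → Polynomial≤ k → Matrix n → Matrix n
  evalᴹ p A u v = sum λ i → p i * (A ^ᴹ toℕ i) u v

{-# OPTIONS --safe #-}
-- Put s = yᵀy and θ = p(λ), so that p(A) y = θ y.  Evaluating the form of p(A)
-- at s x - (xᵀy) y gives θ (xᵀy)² ≤ s (xᵀ p(A) x) for every x.  For a maximum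
-- k-independent set U let x be 1 / y_u at u ∈ U and zero elsewhere.  Then
-- xᵀy = |U|, and since p(A) vanishes at pairs of vertices at distance > k, the
-- form xᵀ p(A) x is Σ_{u ∈ U} p(A)_uu / y_u² ≤ |U| M, where M is the maximum.
-- It remains to cancel |U| > 0.
module Submission where

open import Defs
open import Algebra.Bundles using (CommutativeRing)
import Algebra.Properties.Ring as RingProperties
import Algebra.Properties.Semiring.Sum as SumProperties
import Algebra.Solver.Ring.NaturalCoefficients.Default as SemiringSolver
open import Data.Bool.Base using (Bool; true; false)
open import Data.Fin.Base using (Fin; zero; suc; toℕ)
open import Data.Fin.Properties using (punchInᵢ≢i; toℕ≤pred[n]) renaming (_≟_ to _≟ᶠ_)
open import Data.Fin.Subset using (Subset; _∈_; ∣_∣; ⁅_⁆)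
open import Data.Fin.Subset.Properties using (x∈⁅y⁆⇒x≡y; ∣⁅x⁆∣≡1)
open import Data.Nat.Base as ℕ using (ℕ; zero; suc; NonZero)
import Data.Nat.Properties as ℕ
open import Data.Product.Base using (_,_; proj₁; proj₂)
open import Data.Sum.Base using (_⊎_; inj₁; inj₂)
open import Data.Vec.Base using ([]; _∷_; lookup)
open import Data.Vec.Functional using (Vector; head; tail)
open import Data.Vec.Properties using (lookup⇒[]=)
open import Function.Base using (_∘_)
open import Relation.Binary.Construct.Add.Supremum.Strict ℕ._<_
  using ([_]; [_]<⊤⁺; <⁺-transˡ; [<]-injective)
open import Relation.Binary.PropositionalEquality.Core as ≡ using (_≡_; _≢_)
import Relation.Binary.Reasoning.Setoid as SetoidReasoning
open import Relation.Binary.Structures using (IsStrictPartialOrder)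
open import Relation.Nullary.Construct.Add.Supremum using (⊤⁺; [_])
open import Relation.Nullary.Decidable.Core using (yes; no)
open import Relation.Nullary.Negation.Core using (¬_; contradiction)

private
  variable
    m n : ℕ

-- Distance in terms of walks.

module _ (G : Graph n) where
  open Graph G

  far⇒no-walk : ∀ {k l u v} → Far G k u v → l ℕ.≤ k → ¬ Walk G l u v
  far⇒no-walk far l≤k p =
    ℕ.<⇒≱ ([<]-injective (<⁺-transˡ ℕ.<-≤-trans far (dist-minimal G p))) l≤k

  -- A finite value of `dist` is the length of an actual walk, by `dist-sound`, so it must exceed
  -- `k`. Together with `far⇒no-walk`, this reduces every later claim about distance to manipulating
  -- walks.
  no-walk⇒far : ∀ {k u v} → (∀ {l} → l ℕ.≤ k → ¬ Walk G l u v) → Far G k u v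
  no-walk⇒far {k} {u} {v} none with dist G u v in eq
  ... | ⊤⁺    = [ k ]<⊤⁺
  ... | [ l ] = [ ℕ.≰⇒> (λ l≤k → none l≤k (dist-sound G eq)) ]

  far-mono : ∀ {k l u v} → l ℕ.≤ k → Far G k u v → Far G l u v
  far-mono l≤k far = no-walk⇒far λ i≤l → far⇒no-walk far (ℕ.≤-trans i≤l l≤k)

  far⇒≢ : ∀ {k u v} → Far G k u v → u ≢ v
  far⇒≢ far ≡.refl = far⇒no-walk far ℕ.z≤n nil

  -- A short walk from `w` would extend by the edge to a short walk from `u`. This drives the
  -- induction in `^ᴹ-far`.
  far-step : ∀ {k u v w} → Far G (suc k) u v → u ~ w → Far G k w v
  far-step far u~w = no-walk⇒far λ l≤k p → far⇒no-walk far (ℕ.s≤s l≤k) (cons u~w p)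

  -- Translates the distance condition in `𝒮` into adjacency: a walk of length at most 1 is empty or
  -- a single edge.
  nonadjacent⇒far : ∀ {u v} → u ≢ v → ¬ (u ~ v) → Far G 1 u v
  nonadjacent⇒far u≢v u≁v = no-walk⇒far λ where
    ℕ.z≤n         nil          → u≢v ≡.refl
    (ℕ.s≤s ℕ.z≤n) (cons e nil) → u≁v e

  singleton-independent : ∀ k u → Independent G k ⁅ u ⁆
  singleton-independent k u i j i∈ j∈ i≢j =
    contradiction (≡.trans (x∈⁅y⁆⇒x≡y u i∈) (≡.sym (x∈⁅y⁆⇒x≡y u j∈))) i≢j

-- The singleton of any vertex is vacuously independent. Positivity is what allows the factor `α` to
-- be cancelled at the end.
independenceNumber-positive : ∀ (G : Graph (suc n)) k → 0 ℕ.< independenceNumber G k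
independenceNumber-positive {n} G k = ≡.subst (ℕ._≤ independenceNumber G k) (∣⁅x⁆∣≡1 {suc n} zero)
  (independenceNumber-max G k ⁅ zero ⁆ (singleton-independent G k zero))

module _ {c ℓ₁ ℓ₂} (R : RealField c ℓ₁ ℓ₂) where
  open LinearAlgebra R hiding (zero)
  open CommutativeRing commutativeRing using (ring; commutativeSemiring)
  open RingProperties ring using (-‿distribˡ-*; -‿distribʳ-*; -‿involutive)
  open SumProperties semiring
    using (sum-cong-≋; sum-remove; sum-replicate-zero; ∑-distrib-+; ∑-comm
          ; *-distribˡ-sum; *-distribʳ-sum)
  open IsStrictPartialOrder isStrictPartialOrder
    using (<-respˡ-≈; <-respʳ-≈) renaming (trans to <-trans; irrefl to <-irrefl)
  open import Algebra.Apartness.Properties.HeytingCommutativeRing heytingCommutativeRing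
    using (x-0≈x)
  open SemiringSolver commutativeSemiring using (solve; con; _:*_; _:+_; _:=_)
  open SetoidReasoning setoid

  -- Ordered field

  -- Constructive substitute for totality of the order: cotransitivity of apartness supplies the
  -- alternatives, and `#⇒<⊎>` orients them. An unwanted orientation is repaired by transitivity
  -- with `x < y`.
  <-cotrans : ∀ {x y} → x < y → ∀ z → x < z ⊎ z < y
  <-cotrans x<y z with #-cotrans (<⇒# x<y) z
  ... | inj₁ x#z with #⇒<⊎> x#z
  ...   | inj₁ x<z = inj₁ x<z
  ...   | inj₂ z<x = inj₂ (<-trans z<x x<y)
  <-cotrans x<y z | inj₂ z#y with #⇒<⊎> z#y
  ...   | inj₁ z<y = inj₂ z<y
  ...   | inj₂ y<z = inj₁ (<-trans x<y y<z)

  ≤-reflexive : ∀ {x y} → x ≈ y → x ≤ y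
  ≤-reflexive x≈y = <-irrefl (sym x≈y)

  ≤-trans : ∀ {x y z} → x ≤ y → y ≤ z → x ≤ z
  ≤-trans {y = y} x≤y y≤z z<x with <-cotrans z<x y
  ... | inj₁ z<y = y≤z z<y
  ... | inj₂ y<x = x≤y y<x

  <-≤-trans : ∀ {x y z} → x < y → y ≤ z → x < z
  <-≤-trans {z = z} x<y y≤z with <-cotrans x<y z
  ... | inj₁ x<z = x<z
  ... | inj₂ z<y = contradiction z<y y≤z

  <⇒≤ : ∀ {x y} → x < y → x ≤ y
  <⇒≤ x<y y<x = <-irrefl refl (<-trans x<y y<x)

  ≤-resp₂-≈ : ∀ {x x′ y y′} → x ≈ x′ → y ≈ y′ → x ≤ y → x′ ≤ y′
  ≤-resp₂-≈ x≈x′ y≈y′ x≤y y′<x′ = x≤y (<-respˡ-≈ (sym y≈y′) (<-respʳ-≈ (sym x≈x′) y′<x′))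

  -x+[x+y]≈y : ∀ x y → - x + (x + y) ≈ y
  -x+[x+y]≈y x y = begin
    - x + (x + y)  ≈⟨ +-assoc (- x) x y ⟨
    (- x + x) + y  ≈⟨ +-congʳ (-‿inverseˡ x) ⟩
    0# + y         ≈⟨ +-identityˡ y ⟩
    y              ∎

  +-monoʳ-≤ : ∀ z {x y} → x ≤ y → z + x ≤ z + y
  +-monoʳ-≤ z {x} {y} x≤y z+y<z+x =
    x≤y (<-respˡ-≈ (-x+[x+y]≈y z y) (<-respʳ-≈ (-x+[x+y]≈y z x) (+-monoʳ-< (- z) z+y<z+x)))

  +-mono-≤ : ∀ {x y u v} → x ≤ y → u ≤ v → x + u ≤ y + v
  +-mono-≤ {x} {y} {u} {v} x≤y u≤v = ≤-trans (+-monoʳ-≤ x u≤v)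
    (≤-resp₂-≈ (+-comm v x) (+-comm v y) (+-monoʳ-≤ v x≤y))

  *-monoʳ-< : ∀ {z x y} → 0# < z → x < y → z * x < z * y
  *-monoʳ-< {z} {x} {y} 0<z x<y =
    <-respˡ-≈ (+-identityʳ (z * x)) (<-respʳ-≈ zx+zd≈zy (+-monoʳ-< (z * x) (*-pos 0<z 0<d)))
    where
    0<d : 0# < - x + y
    0<d = <-respˡ-≈ (-‿inverseˡ x) (+-monoʳ-< (- x) x<y)

    zx+zd≈zy : z * x + z * (- x + y) ≈ z * y
    zx+zd≈zy = begin
      z * x + z * (- x + y)  ≈⟨ distribˡ z x (- x + y) ⟨
      z * (x + (- x + y))    ≈⟨ *-congˡ (+-assoc x (- x) y) ⟨
      z * ((x - x) + y)      ≈⟨ *-congˡ (+-congʳ (-‿inverseʳ x)) ⟩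
      z * (0# + y)           ≈⟨ *-congˡ (+-identityˡ y) ⟩
      z * y                  ∎

  *-cancelˡ-≤ : ∀ {z x y} → 0# < z → z * x ≤ z * y → x ≤ y
  *-cancelˡ-≤ 0<z zx≤zy y<x = zx≤zy (*-monoʳ-< 0<z y<x)

  *-monoʳ-≤ : ∀ {z x y} → 0# < z → x ≤ y → z * x ≤ z * y
  *-monoʳ-≤ {x = x} {y} 0<z x≤y zy<zx = <-irrefl (*-congˡ (sym x≈y)) zy<zx
    where
    x≈y : x ≈ y
    -- `x ≤ y` cannot be split into `x < y` or `x ≈ y`. But once `z * y < z * x` is assumed, both
    -- orientations of `x # y` are absurd, so tightness of apartness gives equality.
    x≈y = proj₁ (tight x y) λ x#y → case-# (#⇒<⊎> x#y)
      where
      case-# : ¬ (x < y ⊎ y < x)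
      case-# (inj₁ x<y) = <-irrefl refl (<-trans (*-monoʳ-< 0<z x<y) zy<zx)
      case-# (inj₂ y<x) = x≤y y<x

  square-positive : ∀ {x} → x # 0# → 0# < x * x
  square-positive {x} x#0 with #⇒<⊎> x#0
  ... | inj₂ 0<x = *-pos 0<x 0<x
  ... | inj₁ x<0 = <-respʳ-≈ [-x][-x]≈xx (*-pos 0<-x 0<-x)
    where
    0<-x : 0# < - x
    0<-x = <-respˡ-≈ (-‿inverseˡ x) (<-respʳ-≈ (+-identityʳ (- x)) (+-monoʳ-< (- x) x<0))

    [-x][-x]≈xx : - x * - x ≈ x * x
    [-x][-x]≈xx = begin
      - x * - x      ≈⟨ -‿distribˡ-* x (- x) ⟨
      - (x * - x)    ≈⟨ -‿cong (-‿distribʳ-* x x) ⟨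
      - - (x * x)    ≈⟨ -‿involutive (x * x) ⟩
      x * x          ∎

  fromℕ-positive : ∀ {m} → 0 ℕ.< m → 0# < fromℕ m
  fromℕ-positive {suc zero}    _ = <-respʳ-≈ (sym (+-identityʳ 1#)) 0<1
  fromℕ-positive {suc (suc m)} _ = <-trans 0<1
    (<-respˡ-≈ (+-identityʳ 1#) (+-monoʳ-< 1# (fromℕ-positive {suc m} (ℕ.s≤s ℕ.z≤n))))

  reciprocal-inverseˡ : ∀ x (x#0 : x # 0#) → reciprocal x x#0 * x ≈ 1#
  reciprocal-inverseˡ x x#0 =
    -- `#⇒invertible` supplies an inverse of the difference `x - 0#`, not literally of `x`.
    trans (*-congˡ (sym (x-0≈x x))) (proj₁ (proj₂ (#⇒invertible x#0)))

  ≤-maximum : (f : Vector Carrier (suc n)) → ∀ u → f u ≤ maximum f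
  ≤-maximum {zero}  f zero    = ≤-reflexive refl
  ≤-maximum {suc n} f zero    = proj₁ (∨-supremum (head f) (maximum (tail f)))
  ≤-maximum {suc n} f (suc u) = ≤-trans (≤-maximum (tail f) u)
    (proj₁ (proj₂ (∨-supremum (head f) (maximum (tail f)))))

  -- Finite sums

  sum-mono-≤ : {f g : Vector Carrier n} → (∀ i → f i ≤ g i) → sum f ≤ sum g
  sum-mono-≤ {zero}  f≤g = ≤-reflexive refl
  sum-mono-≤ {suc n} f≤g = +-mono-≤ (f≤g zero) (sum-mono-≤ (f≤g ∘ suc))

  sum-zero : {f : Vector Carrier n} → (∀ i → f i ≈ 0#) → sum f ≈ 0#
  sum-zero {n} f≈0 = trans (sum-cong-≋ f≈0) (sum-replicate-zero n)

  sum-positive : {f : Vector Carrier (suc n)} → (∀ i → 0# < f i) → 0# < sum f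
  sum-positive {n} {f} 0<f = <-≤-trans (0<f zero)
    (≤-resp₂-≈ (+-identityʳ (f zero)) refl (+-monoʳ-≤ (f zero) 0≤rest))
    where
    0≤rest : 0# ≤ sum (tail f)
    0≤rest = ≤-resp₂-≈ (sum-replicate-zero n) refl (sum-mono-≤ (<⇒≤ ∘ 0<f ∘ suc))

  sum-single : ∀ (f : Vector Carrier n) i → (∀ j → j ≢ i → f j ≈ 0#) → sum f ≈ f i
  sum-single {suc n} f i f≈0 = trans (sum-remove {i = i} f)
    (trans (+-congˡ (sum-zero λ j → f≈0 _ (punchInᵢ≢i i j))) (+-identityʳ (f i)))

  -- Dot products and matrices

  ·-cong : {x x′ y y′ : Vector Carrier n} → (∀ i → x i ≈ x′ i) → (∀ i → y i ≈ y′ i) →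
           x · y ≈ x′ · y′
  ·-cong x≈x′ y≈y′ = sum-cong-≋ λ i → *-cong (x≈x′ i) (y≈y′ i)

  ·-congˡ : (x : Vector Carrier n) {y y′ : Vector Carrier n} → (∀ i → y i ≈ y′ i) →
            x · y ≈ x · y′
  ·-congˡ x = ·-cong λ _ → refl

  ·-comm : (x y : Vector Carrier n) → x · y ≈ y · x
  ·-comm x y = sum-cong-≋ λ i → *-comm (x i) (y i)

  x·[yc]≈[x·y]c : (x y : Vector Carrier n) (c : Carrier) → x · (λ i → y i * c) ≈ (x · y) * c
  x·[yc]≈[x·y]c x y c = trans (sum-cong-≋ λ i → sym (*-assoc (x i) (y i) c))
    (sym (*-distribʳ-sum c λ i → x i * y i))

  ·-linearʳ : (x v w : Vector Carrier n) (a b : Carrier) →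
              x · (λ i → v i * a + w i * b) ≈ (x · v) * a + (x · w) * b
  ·-linearʳ x v w a b = begin
    x · (λ i → v i * a + w i * b)
      ≈⟨ sum-cong-≋ (λ i → distribˡ (x i) (v i * a) (w i * b)) ⟩
    sum (λ i → x i * (v i * a) + x i * (w i * b))
      ≈⟨ ∑-distrib-+ (λ i → x i * (v i * a)) (λ i → x i * (w i * b)) ⟩
    x · (λ i → v i * a) + x · (λ i → w i * b)
      ≈⟨ +-cong (x·[yc]≈[x·y]c x v a) (x·[yc]≈[x·y]c x w b) ⟩
    (x · v) * a + (x · w) * b
      ∎

  ·-linearˡ : (v w x : Vector Carrier n) (a b : Carrier) →
              (λ i → v i * a + w i * b) · x ≈ (v · x) * a + (w · x) * b
  ·-linearˡ v w x a b = trans (·-comm _ x) (trans (·-linearʳ x v w a b)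
    (+-cong (*-congʳ (·-comm x v)) (*-congʳ (·-comm x w))))

  -- Interchange of two finite sums. `B` may be rectangular so that `x` can also be the coefficient
  -- vector of a polynomial, with the rows of `B` indexed by degree.
  ·-assoc : (x : Vector Carrier m) (B : Fin m → Fin n → Carrier) (y : Vector Carrier n) →
            (λ j → x · (λ i → B i j)) · y ≈ x · (λ i → B i · y)
  ·-assoc x B y = begin
    (λ j → x · (λ i → B i j)) · y
      ≈⟨ sum-cong-≋ (λ j → *-distribʳ-sum (y j) λ i → x i * B i j) ⟩
    sum (λ j → sum λ i → x i * B i j * y j)
      ≈⟨ ∑-comm (λ j i → x i * B i j * y j) ⟩
    sum (λ i → sum λ j → x i * B i j * y j)
      ≈⟨ sum-cong-≋ (λ i → sum-cong-≋ λ j → *-assoc (x i) (B i j) (y j)) ⟩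
    sum (λ i → sum λ j → x i * (B i j * y j))
      ≈⟨ sum-cong-≋ (λ i → *-distribˡ-sum (x i) λ j → B i j * y j) ⟨
    x · (λ i → B i · y)
      ∎

  self-adjoint : (B : Matrix n) → SymmetricMatrix B → ∀ x y → x · (B *ᵥ y) ≈ (B *ᵥ x) · y
  self-adjoint B B-sym x y = trans (sym (·-assoc x B y))
    (·-cong (λ j → trans (·-comm x λ i → B i j) (·-cong (λ i → B-sym i j) λ _ → refl))
      λ _ → refl)

  1ᴹ-diagonal : (u : Fin n) → 1ᴹ u u ≈ 1#
  1ᴹ-diagonal u with u ≟ᶠ u
  ... | yes _   = refl
  ... | no  u≢u = contradiction ≡.refl u≢u

  1ᴹ-off-diagonal : {u v : Fin n} → u ≢ v → 1ᴹ u v ≈ 0#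
  1ᴹ-off-diagonal {u = u} {v} u≢v with u ≟ᶠ v
  ... | yes u≡v = contradiction u≡v u≢v
  ... | no  _   = refl

  1ᴹ-identity : ∀ (y : Vector Carrier n) u → (1ᴹ *ᵥ y) u ≈ y u
  1ᴹ-identity y u = begin
    (1ᴹ *ᵥ y) u   ≈⟨ sum-single _ u (λ v v≢u →
                       trans (*-congʳ (1ᴹ-off-diagonal (v≢u ∘ ≡.sym))) (zeroˡ (y v))) ⟩
    1ᴹ u u * y u  ≈⟨ *-congʳ (1ᴹ-diagonal u) ⟩
    1# * y u      ≈⟨ *-identityˡ (y u) ⟩
    y u           ∎

  -- Eigenvectors of powers and polynomials of a matrix.

  module _ (A : Matrix n) {μ : Carrier} {y : Vector Carrier n}
           (Ay≈μy : ∀ u → (A *ᵥ y) u ≈ μ * y u) where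

    ^ᴹ-eigenvector : ∀ m u → (A ^ᴹ m *ᵥ y) u ≈ μ ^ m * y u
    ^ᴹ-eigenvector zero    u = trans (1ᴹ-identity y u) (sym (*-identityˡ (y u)))
    ^ᴹ-eigenvector (suc m) u = begin
      (A ^ᴹ suc m *ᵥ y) u              ≈⟨ ·-assoc (A u) (A ^ᴹ m) y ⟩
      A u · (A ^ᴹ m *ᵥ y)              ≈⟨ ·-congˡ (A u) (^ᴹ-eigenvector m) ⟩
      A u · (λ w → μ ^ m * y w)        ≈⟨ ·-congˡ (A u) (λ w → *-comm (μ ^ m) (y w)) ⟩
      A u · (λ w → y w * μ ^ m)        ≈⟨ x·[yc]≈[x·y]c (A u) y (μ ^ m) ⟩
      (A *ᵥ y) u * μ ^ m               ≈⟨ *-congʳ (Ay≈μy u) ⟩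
      μ * y u * μ ^ m                  ≈⟨ *-assoc μ (y u) (μ ^ m) ⟩
      μ * (y u * μ ^ m)                ≈⟨ *-congˡ (*-comm (y u) (μ ^ m)) ⟩
      μ * (μ ^ m * y u)                ≈⟨ *-assoc μ (μ ^ m) (y u) ⟨
      μ ^ suc m * y u                  ∎

    -- An entry of `evalᴹ p A` is the dot product of `p` with the corresponding entries of the
    -- powers of `A`, so `·-assoc` reduces the claim to the powers.
    evalᴹ-eigenvector : ∀ {k} (p : Polynomial≤ k) u → (evalᴹ p A *ᵥ y) u ≈ eval p μ * y u
    evalᴹ-eigenvector p u = begin
      (evalᴹ p A *ᵥ y) u               ≈⟨ ·-assoc p (λ i → (A ^ᴹ toℕ i) u) y ⟩
      p · (λ i → (A ^ᴹ toℕ i *ᵥ y) u)  ≈⟨ ·-congˡ p (λ i → ^ᴹ-eigenvector (toℕ i) u) ⟩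
      p · (λ i → μ ^ toℕ i * y u)      ≈⟨ x·[yc]≈[x·y]c p (λ i → μ ^ toℕ i) (y u) ⟩
      eval p μ * y u                   ∎

  -- Vanishing of matrix polynomials at distant vertices.

  module _ (G : Graph n) (A : Matrix n) (A∈𝒮 : 𝒮 G A) where
    open Graph G

    -- By induction, every summand `A u w * (A ^ᴹ m) w v` has a zero factor. If `w` is `u` or a
    -- neighbour of `u`, then `w` is still at distance more than `m` from `v`; otherwise `A u w` is
    -- zero since `A` lies in `𝒮`. The case `w = u` is separate because diagonal entries are
    -- arbitrary.
    ^ᴹ-far : ∀ m {u v} → Far G m u v → (A ^ᴹ m) u v ≈ 0#
    ^ᴹ-far zero    far = 1ᴹ-off-diagonal (far⇒≢ G far)
    ^ᴹ-far (suc m) {u} {v} far = sum-zero term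
      where
      term : ∀ w → A u w * (A ^ᴹ m) w v ≈ 0#
      term w with u ≟ᶠ w | u ~? w
      ... | yes ≡.refl | _       =
        trans (*-congˡ (^ᴹ-far m (far-mono G (ℕ.n≤1+n m) far))) (zeroʳ (A u w))
      ... | no  _      | yes u~w =
        trans (*-congˡ (^ᴹ-far m (far-step G far u~w))) (zeroʳ (A u w))
      ... | no  u≢w    | no  u≁w =
        trans (*-congʳ (proj₂ A∈𝒮 u w (nonadjacent⇒far G u≢w u≁w))) (zeroˡ ((A ^ᴹ m) w v))

    evalᴹ-far : ∀ {k} (p : Polynomial≤ k) {u v} → Far G k u v → evalᴹ p A u v ≈ 0#
    evalᴹ-far p far = sum-zero λ i →
      -- The degree bound enters here: every exponent `toℕ i` is at most `k`.
      trans (*-congˡ (^ᴹ-far (toℕ i) (far-mono G (toℕ≤pred[n] i) far))) (zeroʳ (p i))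

  -- An inequality of Cauchy-Schwarz type for an eigenvector.

  module _ (B : Matrix n) (B-psd : PositiveSemidefinite B) {θ : Carrier} {y : Vector Carrier n}
           (By≈θy : ∀ u → (B *ᵥ y) u ≈ θ * y u) (0<y·y : 0# < y · y) where

    -- The form of `B` splits along `y` and its orthogonal complement. The complement contributes a
    -- nonnegative amount, and dropping it leaves the part along `y`.
    eigenvector-bound : ∀ x → θ * ((x · y) * (x · y)) ≤ (y · y) * (x · (B *ᵥ x))
    eigenvector-bound x = ≤-resp₂-≈ (+-identityʳ _) θtt+[sq-θtt]≈sq
      (+-monoʳ-≤ (θ * (t * t)) 0≤sq-θtt)
      where
      s t d q : Carrier
      s = y · y
      t = x · y
      d = - t
      q = x · (B *ᵥ x)

      z : Vector Carrier n
      -- This is `s` times the component of `x` orthogonal to `y`; the scaling avoids dividing by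
      -- `s`.
      z u = x u * s + y u * d

      x·By : x · (B *ᵥ y) ≈ t * θ
      x·By = trans (·-congˡ x λ u → trans (By≈θy u) (*-comm θ (y u))) (x·[yc]≈[x·y]c x y θ)

      y·By : y · (B *ᵥ y) ≈ s * θ
      y·By = trans (·-congˡ y λ u → trans (By≈θy u) (*-comm θ (y u))) (x·[yc]≈[x·y]c y y θ)

      y·Bx : y · (B *ᵥ x) ≈ t * θ
      y·Bx = trans (self-adjoint B (proj₁ B-psd) y x) (trans (·-comm (B *ᵥ y) x) x·By)

      -- Treating d as independent of t makes the expansion a semiring identity;
      -- t + d ≈ 0 is used only afterwards.
      expand : z · (B *ᵥ z) ≈ s * (s * q + d * θ * (t + (t + d)))
      expand = begin
        z · (B *ᵥ z)
          ≈⟨ ·-congˡ z (λ u → ·-linearʳ (B u) x y s d) ⟩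
        z · (λ u → (B *ᵥ x) u * s + (B *ᵥ y) u * d)
          ≈⟨ ·-linearʳ z (B *ᵥ x) (B *ᵥ y) s d ⟩
        (z · (B *ᵥ x)) * s + (z · (B *ᵥ y)) * d
          ≈⟨ +-cong (*-congʳ (·-linearˡ x y (B *ᵥ x) s d))
                    (*-congʳ (·-linearˡ x y (B *ᵥ y) s d)) ⟩
        (q * s + (y · (B *ᵥ x)) * d) * s + ((x · (B *ᵥ y)) * s + (y · (B *ᵥ y)) * d) * d
          ≈⟨ +-cong (*-congʳ (+-congˡ (*-congʳ y·Bx)))
                    (*-congʳ (+-cong (*-congʳ x·By) (*-congʳ y·By))) ⟩
        (q * s + t * θ * d) * s + (t * θ * s + s * θ * d) * d
          ≈⟨ solve 5 (λ s t d q θ →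
               (q :* s :+ t :* θ :* d) :* s :+ (t :* θ :* s :+ s :* θ :* d) :* d
                 := s :* (s :* q :+ d :* θ :* (t :+ (t :+ d))))
               refl s t d q θ ⟩
        s * (s * q + d * θ * (t + (t + d)))
          ∎

      collapse : s * q + d * θ * (t + (t + d)) ≈ s * q + d * (θ * t)
      collapse = +-congˡ (trans (*-congˡ (trans (+-congˡ (-‿inverseʳ t)) (+-identityʳ t)))
        (*-assoc d θ t))

      0≤sq-θtt : 0# ≤ s * q + d * (θ * t)
      -- The form at `z` carries an extra factor `s`, which is positive and cancels.
      0≤sq-θtt = *-cancelˡ-≤ 0<y·y (≤-resp₂-≈ (sym (zeroʳ s))
        (trans expand (*-congˡ collapse)) (proj₂ B-psd z))

      θtt+[sq-θtt]≈sq : θ * (t * t) + (s * q + d * (θ * t)) ≈ s * q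
      θtt+[sq-θtt]≈sq = begin
        θ * (t * t) + (s * q + d * (θ * t))
          ≈⟨ solve 5 (λ s t d q θ → θ :* (t :* t) :+ (s :* q :+ d :* (θ :* t))
                                      := s :* q :+ (t :+ d) :* (θ :* t)) refl s t d q θ ⟩
        s * q + (t + d) * (θ * t)
          ≈⟨ +-congˡ (trans (*-congʳ (-‿inverseʳ t)) (zeroˡ (θ * t))) ⟩
        s * q + 0#
          ≈⟨ +-identityʳ (s * q) ⟩
        s * q
          ∎

  -- Indicator vectors of subsets

  [_]# : Bool → Carrier
  [ true  ]# = 1#
  [ false ]# = 0#

  indicator : Subset n → Vector Carrier n
  indicator U u = [ lookup U u ]#

  sum-indicator : (U : Subset n) → sum (indicator U) ≈ fromℕ ∣ U ∣
  sum-indicator []          = refl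
  sum-indicator (true  ∷ U) = +-congˡ (sum-indicator U)
  sum-indicator (false ∷ U) = trans (+-identityˡ _) (sum-indicator U)

  module _ (B : Matrix n) (U : Subset n)
           (B-offdiag : ∀ u v → u ∈ U → v ∈ U → u ≢ v → B u v ≈ 0#)
           (a : Vector Carrier n) where

    private
      x : Vector Carrier n
      x u = indicator U u * a u

    -- Only diagonal terms survive: for `u` in `U` and `v` different from `u`, either `v` lies
    -- outside `U` and `x v` is zero, or `B u v` is zero by `B-offdiag`.
    indicator-form : x · (B *ᵥ x) ≈ sum λ u → indicator U u * (B u u * (a u * a u))
    indicator-form = sum-cong-≋ term
      where
      term : ∀ u → x u * (B u · x) ≈ indicator U u * (B u u * (a u * a u))
      term u with lookup U u in Uu
      ... | false = trans (*-congʳ (zeroˡ (a u))) (trans (zeroˡ _) (sym (zeroˡ _)))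
      ... | true  = begin
        1# * a u * (B u · x)             ≈⟨ *-congˡ (sum-single _ u offdiag) ⟩
        -- `sum-single` reintroduces `lookup U u` through `x u`, after the `with` abstraction, so
        -- `Uu` has to be applied by hand.
        1# * a u * (B u u * x u)         ≡⟨ ≡.cong (λ b → 1# * a u * (B u u * ([ b ]# * a u))) Uu ⟩
        1# * a u * (B u u * (1# * a u))  ≈⟨ solve 2 (λ a b → con 1 :* a :* (b :* (con 1 :* a))
                                              := con 1 :* (b :* (a :* a))) refl (a u) (B u u) ⟩
        1# * (B u u * (a u * a u))       ∎
        where
        offdiag : ∀ v → v ≢ u → B u v * x v ≈ 0#
        offdiag v v≢u with lookup U v in Uv
        ... | false = trans (*-congˡ (zeroˡ (a v))) (zeroʳ (B u v))
        ... | true  = trans (*-congʳ (B-offdiag u v (lookup⇒[]= u U Uu) (lookup⇒[]= v U Uv)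
                                       (v≢u ∘ ≡.sym)))
                            (zeroˡ (1# * a v))

    indicator-form-≤ : ∀ {M} → (∀ u → B u u * (a u * a u) ≤ M) → x · (B *ᵥ x) ≤ fromℕ ∣ U ∣ * M
    indicator-form-≤ {M} bound = ≤-resp₂-≈ (sym indicator-form)
      (trans (sym (*-distribʳ-sum M (indicator U))) (*-congʳ (sum-indicator U)))
      (sum-mono-≤ term)
      where
      term : ∀ u → indicator U u * (B u u * (a u * a u)) ≤ indicator U u * M
      -- The indicator stays on both sides, so terms outside `U` compare as zero with zero and the
      -- indicators on the right sum to the size of `U`.
      term u with lookup U u
      ... | true  = ≤-resp₂-≈ (sym (*-identityˡ _)) (sym (*-identityˡ M)) (bound u)
      ... | false = ≤-reflexive (trans (zeroˡ _) (sym (zeroˡ M)))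

theorem6 : ∀ {c ℓ₁ ℓ₂} (R : RealField c ℓ₁ ℓ₂) → let open LinearAlgebra R in
    (k : ℕ) → .{{NonZero k}} →
    {n : ℕ} (G : Graph (suc n)) (A : Matrix (suc n)) → 𝒮 G A →
    (μ : Carrier) (y : Vector Carrier (suc n)) → IsEigenvector A μ y →
    (y#0 : ∀ u → y u # 0#) →
    (p : Polynomial≤ k) → PositiveSemidefinite (evalᴹ p A) →
    (p[μ]>0 : 0# < eval p μ) →
    fromℕ (independenceNumber G k)
      ≤ ((y · y) / eval p μ [ 0<⇒#0 p[μ]>0 ])
        * maximum (λ u → evalᴹ p A u u / (y u * y u) [ x#0y#0→xy#0 (y#0 u) (y#0 u) ])
theorem6 R k {n} G A A∈𝒮 μ y (_ , Ay≈μy) y#0 p B-psd p[μ]>0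
  with independenceNumber-attained G k
... | U , U-independent , ∣U∣≡α =
  -- Multiplying the goal by `α` and then by `θ` turns it into `θ * (α * α) ≤ s * (α * M)`, up to
  -- rearrangement. This follows from `eigenvector-bound` at `x` and the bound on its form.
  *-cancelˡ-≤ R (fromℕ-positive R (independenceNumber-positive G k))
    (*-cancelˡ-≤ R p[μ]>0 (≤-resp₂-≈ R (*-congˡ (*-cong x·y≈α x·y≈α)) clear-denominator
      (≤-trans R (eigenvector-bound R B B-psd By≈θy 0<y·y x)
        (*-monoʳ-≤ R 0<y·y form≤αM))))
  where
  open LinearAlgebra R hiding (zero)
  open CommutativeRing commutativeRing using (commutativeSemiring)
  open SumProperties semiring using (sum-cong-≋)
  open SemiringSolver commutativeSemiring using (solve; _:*_; _:=_)
  open SetoidReasoning setoid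

  B = evalᴹ p A
  θ = eval p μ
  s = y · y
  α = fromℕ (independenceNumber G k)

  r : Vector Carrier (suc n)
  r u = reciprocal (y u * y u) (x#0y#0→xy#0 (y#0 u) (y#0 u))

  M = maximum λ u → B u u * r u

  -- y u * r u is 1 / y u, expressed through the reciprocal of y u * y u that
  -- occurs in M.
  x : Vector Carrier (suc n)
  x u = indicator R U u * (y u * r u)

  By≈θy = evalᴹ-eigenvector R A Ay≈μy p

  0<y·y : 0# < s
  0<y·y = sum-positive R λ u → square-positive R (y#0 u)

  r[yy]≈1 : ∀ u → r u * (y u * y u) ≈ 1#
  r[yy]≈1 u = reciprocal-inverseˡ R (y u * y u) (x#0y#0→xy#0 (y#0 u) (y#0 u))

  -- Each vertex of `U` contributes `1 / y u` times `y u`, which is 1.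
  x·y≈α : x · y ≈ α
  x·y≈α = begin
    x · y                                           ≈⟨ sum-cong-≋ (λ u →
      solve 3 (λ i y r → i :* (y :* r) :* y := i :* (r :* (y :* y)))
        refl (indicator R U u) (y u) (r u)) ⟩
    sum (λ u → indicator R U u * (r u * (y u * y u)))  ≈⟨ sum-cong-≋ (λ u →
      trans (*-congˡ (r[yy]≈1 u)) (*-identityʳ (indicator R U u))) ⟩
    sum (indicator R U)                             ≈⟨ sum-indicator R U ⟩
    fromℕ ∣ U ∣                                     ≡⟨ ≡.cong fromℕ ∣U∣≡α ⟩
    α                                               ∎

  -- Since `r u` inverts the square of `y u`, the square of `y u * r u` is `r u` itself, and the
  -- left side is one of the entries under the maximum.
  diagonal-bound : ∀ u → B u u * ((y u * r u) * (y u * r u)) ≤ M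
  diagonal-bound u = ≤-resp₂-≈ R Br≈B[yr][yr] refl (≤-maximum R (λ u → B u u * r u) u)
    where
    Br≈B[yr][yr] : B u u * r u ≈ B u u * ((y u * r u) * (y u * r u))
    Br≈B[yr][yr] = begin
      B u u * r u                          ≈⟨ *-congˡ (*-identityʳ (r u)) ⟨
      B u u * (r u * 1#)                   ≈⟨ *-congˡ (*-congˡ (r[yy]≈1 u)) ⟨
      B u u * (r u * (r u * (y u * y u)))  ≈⟨ *-congˡ (solve 2 (λ y r →
        r :* (r :* (y :* y)) := (y :* r) :* (y :* r)) refl (y u) (r u)) ⟩
      B u u * ((y u * r u) * (y u * r u))  ∎

  form≤αM : x · (B *ᵥ x) ≤ α * M
  form≤αM = ≤-resp₂-≈ R refl (*-congʳ (reflexive (≡.cong fromℕ ∣U∣≡α)))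
    (indicator-form-≤ R B U
      -- Independence of `U` makes distinct members far apart, which is what kills the off-diagonal
      -- entries of `B`.
      (λ u v u∈U v∈U u≢v → evalᴹ-far R G A A∈𝒮 p (U-independent u v u∈U v∈U u≢v))
      (λ u → y u * r u) diagonal-bound)

  θ⁻¹ : Carrier
  θ⁻¹ = reciprocal θ (0<⇒#0 p[μ]>0)

  -- Inserting `θ⁻¹ * θ`, which equals 1, on the left leaves a pure rearrangement of products.
  clear-denominator : s * (α * M) ≈ θ * (α * (s * θ⁻¹ * M))
  clear-denominator = begin
    s * (α * M)                ≈⟨ *-identityˡ _ ⟨
    1# * (s * (α * M))         ≈⟨ *-congʳ (reciprocal-inverseˡ R θ (0<⇒#0 p[μ]>0)) ⟨
    θ⁻¹ * θ * (s * (α * M))    ≈⟨ solve 5 (λ θ⁻¹ θ s α M →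
      θ⁻¹ :* θ :* (s :* (α :* M)) := θ :* (α :* (s :* θ⁻¹ :* M))) refl θ⁻¹ θ s α M ⟩
    θ * (α * (s * θ⁻¹ * M))    ∎
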